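{- If $T$ is an almost-Suslin tree, then $\diamondsuit_T$ holds if and only if $\diamondsuit$ holds.
   Context: A tree is a partial order $(T,<_T)$ in which the set of predecessors of each node is well-ordered; every tree is assumed to have a root, denoted $\emptyset$. For $t\in T$, $t{\downarrow}=\{s\in T\mid s<_T t\}$, $\mathrm{ht}(t)$ is the order type of $t{\downarrow}$, and $T_\alpha$ is the set of nodes of height $\alpha$. The height of $T$ is the least $\alpha$ with $T_\alpha=\emptyset$. An $\omega_1$-tree is a tree of height $\omega_1$ all of whose levels $T_\alpha$ are countable. An antichain is a set of pairwise incomparable nodes. An $\omega_1$-tree $T$ is almost-Suslin if for every antichain $A\subseteq T$ the set $\{\mathrm{ht}(t)\mid t\in A\}$ is nonstationary in $\omega_1$. A set $U\subseteq T$ is special if it is a union of at most countably many antichains; otherwise it is nonspecial. For $X\subseteq T$, a map $f:X\to T$ is regressive if $f(t)<_T t$ for all $t\in X\setminus\{\emptyset\}$. For $T$ of height $\omega_1$, $NS^T$ is the ideal of all $B\subseteq T$ for which there is a regressive $f:B\to T$ such that $f^{ -1}(\{t\})$ is special for every $t\in T$. For a nonspecial tree $T$ of height $\omega_1$, $\diamondsuit_T$ asserts that there is a sequence $(D_t\mid t\in T)$ with $D_t\subseteq t{\downarrow}$ for all $t\in T$ such that for every $X\subseteq T$, $\{t\in T\mid X\cap t{\downarrow}=D_t\}\notin NS^T$. $\diamondsuit$ is Jensen's principle: there is $(D_\alpha)_{\alpha<\omega_1}$ with $D_\alpha\subseteq\alpha$ such that for every $X\subseteq\omega_1$ the set $\{\alpha<\omega_1\mid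 X\cap\alpha=D_\alpha\}$ is stationary. -}

module Defs where

open import Axiom.ExcludedMiddle using (ExcludedMiddle)
open import Data.Nat.Base using (ℕ)
open import Data.Product.Base using (Σ; ∃-syntax; Σ-syntax; _×_; _,_; proj₁)
open import Function.Base using (_on_)
open import Function.Bundles using (Func; Injection)
open import Induction.WellFounded using (WellFounded)
open import Level using (0ℓ) renaming (suc to lsuc)
open import Relation.Binary.Bundles using (Setoid)
open import Relation.Binary.Core using (Rel)
import Relation.Binary.Construct.On as On
open import Relation.Binary.Morphism.Structures using (IsOrderIsomorphism)
open import Relation.Binary.PropositionalEquality
  using (_≡_; _≢_; setoid)
open import Relation.Binary.Structures
  using (IsStrictPartialOrder; IsStrictTotalOrder)
open import Relation.Nullary.Negation using (¬_)
open import Relation.Unary using (Pred; _∈_; _⊆_; _≐_; _∩_; U; _≬_; ⋃; Satisfiable)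

-- The ambient classical logic.  `ExcludedMiddle` decides every type of Set₁
-- (hence, by lifting, every type of Set), not only the propositions, so it
-- yields ¬ ¬ P → P for arbitrary types P and with it the axiom of choice.
-- Sets are types in Set, and subsets of a set are predicates in `Pred A 0ℓ`.
Classical : Set (lsuc (lsuc 0ℓ))
Classical = ExcludedMiddle (lsuc 0ℓ)

-- A subset as a set in its own right.  Elements are compared by their first
-- component only, so that different proofs of membership are not counted.
⟪_⟫ : {A : Set} → Pred A 0ℓ → Setoid 0ℓ 0ℓ
⟪_⟫ {A} P = On.setoid {B = Σ A P} (setoid A) proj₁

Countable : {A : Set} → Pred A 0ℓ → Set
Countable P = Injection ⟪ P ⟫ (setoid ℕ)

record IsWellOrder {A : Set} (_≈_ : Rel A 0ℓ) (_<_ : Rel A 0ℓ) : Set where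
  field
    isStrictTotalOrder : IsStrictTotalOrder _≈_ _<_
    wellFounded        : WellFounded _<_

OrderIsomorphic : {A B : Set} (P : Pred A 0ℓ) (_<₁_ : Rel A 0ℓ)
                  (Q : Pred B 0ℓ) (_<₂_ : Rel B 0ℓ) → Set
OrderIsomorphic P _<₁_ Q _<₂_ =
  ∃[ f ] IsOrderIsomorphism (Setoid._≈_ ⟪ P ⟫) (Setoid._≈_ ⟪ Q ⟫)
                            (_<₁_ on proj₁) (_<₂_ on proj₁) f

-- A set of ordinals of order type ω₁: an uncountable well-order all of whose
-- proper initial segments are countable.  This determines it up to a unique
-- order isomorphism; its elements play the role of the countable ordinals.
record Omega₁ : Set₁ where
  infix 4 _<_
  field
    Carrier           : Set
    _<_               : Rel Carrier 0ℓ
    isWellOrder       : IsWellOrder _≡_ _<_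
    segmentsCountable : ∀ α → Countable (_< α)
    uncountable       : ¬ Countable (U {A = Carrier})

  below : Carrier → Pred Carrier 0ℓ
  below α = _< α

module _ (Ω : Omega₁) where
  open Omega₁ Ω renaming (Carrier to W)

  Unbounded : Pred W 0ℓ → Set
  Unbounded C = ∀ α → ∃[ γ ] γ ∈ C × α < γ

  -- α > 0 and C ∩ α unbounded in α already force α to be a limit ordinal.
  Closed : Pred W 0ℓ → Set
  Closed C = ∀ α → Satisfiable (below α) →
             (∀ β → β < α → ∃[ γ ] γ ∈ C × β < γ × γ < α) → α ∈ C

  Club : Pred W 0ℓ → Set
  Club C = Unbounded C × Closed C

  Stationary : Pred W 0ℓ → Set₁
  Stationary S = ∀ C → Club C → S ≬ C

  Nonstationary : Pred W 0ℓ → Set₁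
  Nonstationary S = ¬ Stationary S

  Diamond : Set₁
  Diamond = Σ[ D ∈ (W → Pred W 0ℓ) ]
              (∀ α → D α ⊆ below α)
            × (∀ (X : Pred W 0ℓ) → Stationary (λ α → (X ∩ below α) ≐ D α))

record Tree : Set₁ where
  infix 4 _<_
  field
    Carrier              : Set
    _<_                  : Rel Carrier 0ℓ
    isStrictPartialOrder : IsStrictPartialOrder _≡_ _<_

  _↓ : Carrier → Pred Carrier 0ℓ
  t ↓ = _< t

  field
    ↓-isWellOrder : ∀ t → IsWellOrder (Setoid._≈_ ⟪ t ↓ ⟫) (_<_ on proj₁)
    root          : Carrier
    root-least    : ∀ t → t ≢ root → root < t

module _ (𝕋 : Tree) where
  open Tree 𝕋 renaming (Carrier to T)

  Antichain : Pred T 0ℓ → Set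
  Antichain A = ∀ s t → s ∈ A → t ∈ A → s ≢ t → ¬ (s < t) × ¬ (t < s)

  -- The antichains 𝒜 n may be empty, so finite unions are included.
  Special : Pred T 0ℓ → Set₁
  Special B = Σ[ 𝒜 ∈ (ℕ → Pred T 0ℓ) ]
                (∀ n → Antichain (𝒜 n)) × B ≐ ⋃[ n ∶ ℕ ] 𝒜 n

  Regressive : (B : Pred T 0ℓ) → Func ⟪ B ⟫ (setoid T) → Set
  Regressive B f = ∀ t (t∈B : t ∈ B) → t ≢ root → Func.to f (t , t∈B) < t

  fibre : (B : Pred T 0ℓ) → Func ⟪ B ⟫ (setoid T) → T → Pred T 0ℓ
  fibre B f s t = Σ[ t∈B ∈ t ∈ B ] Func.to f (t , t∈B) ≡ s

  NS : Pred T 0ℓ → Set₁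
  NS B = Σ[ f ∈ Func ⟪ B ⟫ (setoid T) ]
           Regressive B f × (∀ s → Special (fibre B f s))

  TreeDiamond : Set₁
  TreeDiamond = Σ[ D ∈ (T → Pred T 0ℓ) ]
                  (∀ t → D t ⊆ t ↓)
                × (∀ (X : Pred T 0ℓ) → ¬ NS (λ t → (X ∩ t ↓) ≐ D t))

  module _ (Ω : Omega₁) where
    open Omega₁ Ω using (below) renaming (Carrier to W; _<_ to _<Ω_)

    -- `Level α t`: the order type of t ↓ is α, i.e. ht t = α.
    Level : W → Pred T 0ℓ
    Level α t = OrderIsomorphic (t ↓) _<_ (below α) _<Ω_

    -- `Level-ω₁ t`: the order type of t ↓ is ω₁ itself.
    Level-ω₁ : Pred T 0ℓ
    Level-ω₁ t = OrderIsomorphic (t ↓) _<_ (U {A = W}) _<Ω_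

    -- ω₁ is the least α for which there is no node of height α.
    record Height-ω₁ : Set where
      field
        levels-nonempty : ∀ α → Satisfiable (Level α)
        level-ω₁-empty  : ¬ Satisfiable Level-ω₁

    record IsOmega₁Tree : Set where
      field
        height-ω₁        : Height-ω₁
        levels-countable : ∀ α → Countable (Level α)

    heights : Pred T 0ℓ → Pred W 0ℓ
    heights A α = ∃[ t ] t ∈ A × t ∈ Level α

    record AlmostSuslin : Set₁ where
      field
        isOmega₁Tree             : IsOmega₁Tree
        antichains-nonstationary : ∀ A → Antichain A → Nonstationary Ω (heights A)

-- Fix an injection tuple : ω₁ × ω → ω₁; club many α are closed under it.
--
-- From ◇ to ◇_T: code the nodes of T by countable ordinals, using the height
-- and an enumeration of each level, and let D_t decode the guess at ht t below t.
-- If a regressive f with special fibres were defined on the nodes where X is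
-- guessed, then each fibre, a countable union of antichains, has its heights
-- outside some club.  Diagonalising these clubs over s ∈ T gives a club of α,
-- hence one at which X is guessed, such that no node of height α is sent by f to
-- a node below it.
--
-- From ◇_T to ◇: a set of nodes whose heights avoid a club lies in NS^T, so the
-- guesses along the countably many nodes of height α form a countable family of
-- guesses at α that is correct stationarily often; Kunen's coding trick then
-- selects a single guess at each α.

module Submission where

open import Defs
open import Data.Bool.Base using (Bool; true; false)
open import Data.Empty using (⊥)
open import Data.Nat.Base as ℕ using (ℕ; zero; suc)
import Data.Nat.Induction as ℕ
import Data.Nat.Properties as ℕ
open import Data.Product.Base using (Σ; Σ-syntax; ∃; ∃-syntax; _×_; _,_; proj₁; proj₂)
open import Data.Product.Relation.Binary.Lex.Strict
  using (×-Lex; ×-wellFounded; ×-isStrictTotalOrder)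
open import Data.Sum.Base using (_⊎_; inj₁; inj₂; [_,_])
open import Function.Base using (_∘_; _on_; id; const)
open import Function.Bundles using (_⇔_; mk⇔; Func; Injection)
open import Induction.WellFounded using (WellFounded; Acc; acc; module All; module FixPoint)
open import Level using (0ℓ; Lift; lift; lower)
open import Relation.Binary.Core using (Rel)
open import Relation.Binary.Definitions using (Tri; tri<; tri≈; tri>)
open import Relation.Binary.Morphism.Structures using (IsOrderIsomorphism)
open import Relation.Binary.PropositionalEquality
  using (_≡_; _≢_; refl; sym; trans; cong; cong₂; subst; setoid)
open import Relation.Binary.Structures using (IsStrictPartialOrder; IsStrictTotalOrder)
open import Relation.Nullary.Decidable using (Dec; yes; no; map′; decidable-stable)
open import Relation.Nullary.Negation using (¬_; contradiction)
open import Relation.Unary using (Pred; _∈_; _⊆_; _≐_; _∩_; U; _≬_; Satisfiable)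

-- Pairing of natural numbers and codes for countable sets.

square+-mono-< : ∀ {m s m′ s′} → m ℕ.≤ s → s ℕ.< s′ → s ℕ.* s ℕ.+ m ℕ.< s′ ℕ.* s′ ℕ.+ m′
square+-mono-< {m} {s} {m′} {s′} m≤s s<s′ = begin-strict
  s ℕ.* s ℕ.+ m      ≤⟨ ℕ.+-monoʳ-≤ (s ℕ.* s) m≤s ⟩
  s ℕ.* s ℕ.+ s      ≡⟨ ℕ.+-comm (s ℕ.* s) s ⟩
  suc s ℕ.* s        <⟨ ℕ.*-monoʳ-< (suc s) (ℕ.n<1+n s) ⟩
  suc s ℕ.* suc s    ≤⟨ ℕ.*-mono-≤ s<s′ s<s′ ⟩
  s′ ℕ.* s′          ≤⟨ ℕ.m≤m+n (s′ ℕ.* s′) m′ ⟩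
  s′ ℕ.* s′ ℕ.+ m′   ∎
  where open ℕ.≤-Reasoning

abstract
  pair : ℕ → ℕ → ℕ
  pair m n = (m ℕ.+ n) ℕ.* (m ℕ.+ n) ℕ.+ m

  -- With s = m + n, the code s² + m is at least s² and below (s + 1)², so it determines s, then m
  -- and n.
  pair-injective : ∀ {m n m′ n′} → pair m n ≡ pair m′ n′ → m ≡ m′ × n ≡ n′
  pair-injective {m} {n} {m′} {n′} eq with ℕ.<-cmp (m ℕ.+ n) (m′ ℕ.+ n′)
  ... | tri< lt _ _ = contradiction eq (ℕ.<⇒≢ (square+-mono-< (ℕ.m≤m+n m n) lt))
  ... | tri> _ _ gt = contradiction (sym eq) (ℕ.<⇒≢ (square+-mono-< (ℕ.m≤m+n m′ n′) gt))
  ... | tri≈ _ s≡s′ _ = m≡m′ , ℕ.+-cancelˡ-≡ m n n′ (trans s≡s′ (cong (ℕ._+ n′) (sym m≡m′)))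
    where
    m≡m′ : m ≡ m′
    m≡m′ = ℕ.+-cancelˡ-≡ ((m ℕ.+ n) ℕ.* (m ℕ.+ n)) m m′
             (trans eq (cong (λ s → s ℕ.* s ℕ.+ m′) (sym s≡s′)))

-- A total code, injective on P only: unlike the injections of `Countable`, it
-- does not take membership proofs as arguments.
Coded : {A : Set} → Pred A 0ℓ → Set
Coded {A} P = Σ[ code ∈ (A → ℕ) ] (∀ {x y} → P x → P y → code x ≡ code y → x ≡ y)

Coded-⊆ : {A : Set} {P Q : Pred A 0ℓ} → P ⊆ Q → Coded Q → Coded P
Coded-⊆ P⊆Q (code , inj) = code , λ Px Py → inj (P⊆Q Px) (P⊆Q Py)

Coded-×ℕ : {A : Set} {P : Pred A 0ℓ} → Coded P → Coded {A × ℕ} (P ∘ proj₁)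
Coded-×ℕ (code , inj) = (λ (a , n) → pair (code a) n) , λ Px Py eq →
  let a≡b , m≡n = pair-injective eq in cong₂ _,_ (inj Px Py a≡b) m≡n

Coded-⊎ : {A B : Set} {P : Pred (A ⊎ B) 0ℓ} → Coded (P ∘ inj₁) → Coded (P ∘ inj₂) → Coded P
Coded-⊎ {A} {B} {P} (code₁ , injective₁) (code₂ , injective₂) = code , injective
  where
  code : A ⊎ B → ℕ
  code = [ pair 0 ∘ code₁ , pair 1 ∘ code₂ ]

  injective : ∀ {x y} → P x → P y → code x ≡ code y → x ≡ y
  injective {inj₁ a} {inj₁ b} p q eq = cong inj₁ (injective₁ p q (proj₂ (pair-injective {0} {_} {0} eq)))
  injective {inj₁ a} {inj₂ b} p q eq = contradiction (proj₁ (pair-injective {0} {_} {1} eq)) λ ()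
  injective {inj₂ a} {inj₁ b} p q eq = contradiction (proj₁ (pair-injective {1} {_} {0} eq)) λ ()
  injective {inj₂ a} {inj₂ b} p q eq = cong inj₂ (injective₂ p q (proj₂ (pair-injective {1} {_} {1} eq)))

Coded-Bool : Coded (U {A = Bool})
Coded-Bool = code , injective
  where
  code : Bool → ℕ
  code false = 0
  code true  = 1

  injective : ∀ {x y} → x ∈ U → y ∈ U → code x ≡ code y → x ≡ y
  injective {false} {false} _ _ _ = refl
  injective {true}  {true}  _ _ _ = refl

module _ (em : Classical) where

  dec : (P : Set) → Dec P
  dec P = map′ lower lift (em {Lift _ P})

  byContradiction : {P : Set} → ¬ ¬ P → P
  byContradiction = decidable-stable (dec _)

  byContradiction₁ : {P : Set₁} → ¬ ¬ P → P
  byContradiction₁ = decidable-stable em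

  countable⇒coded : {A : Set} {P : Pred A 0ℓ} → Countable P → Coded P
  countable⇒coded {A} {P} inj = code , injective
    where
    open Injection inj using (to) renaming (injective to to-injective)

    code : A → ℕ
    code x with dec (P x)
    ... | yes p = to (x , p)
    ... | no _  = 0

    injective : ∀ {x y} → P x → P y → code x ≡ code y → x ≡ y
    injective {x} {y} Px Py eq with dec (P x) | dec (P y)
    ... | yes _ | yes _ = to-injective eq
    ... | no ¬p | _     = contradiction Px ¬p
    ... | yes _ | no ¬p = contradiction Py ¬p

  -- Each fibre of the code within `B` has at most one element, hence is an antichain.
  coded⇒special : ∀ 𝕋 {B} → Coded B → Special 𝕋 B
  coded⇒special 𝕋 {B} (code , injective) =
    (λ n t → B t × code t ≡ n) ,
    (λ n s t (s∈B , cs) (t∈B , ct) s≢t → contradiction (injective s∈B t∈B (trans cs (sym ct))) s≢t) ,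
    (λ {t} t∈B → code t , t∈B , refl) ,
    (λ (_ , t∈B , _) → t∈B)

  -- The well-order ω₁ and its regularity.

  module Ordinal (Ω : Omega₁) where
    open Omega₁ Ω renaming (Carrier to W)
    open IsWellOrder isWellOrder
    open IsStrictTotalOrder isStrictTotalOrder using (compare; irrefl)
      renaming (trans to <-trans)

    Least : Pred W 0ℓ → Pred W 0ℓ
    Least P m = P m × (∀ {y} → y < m → ¬ P y)

    abstract
      least : (P : Pred W 0ℓ) → ∃ P → ∃ (Least P)
      least P (x , Px) = All.wfRec wellFounded 0ℓ (λ x → P x → ∃ (Least P)) step x Px
        where
        step : ∀ x → (∀ {y} → y < x → P y → ∃ (Least P)) → P x → ∃ (Least P)
        step x rec Px with dec (∃[ y ] y < x × P y)
        ... | yes (y , y<x , Py) = rec y<x Py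
        ... | no none            = x , Px , λ y<x Py → none (_ , y<x , Py)

      least-cong : ∀ {P Q} → P ≐ Q → ∀ p q → proj₁ (least P p) ≡ proj₁ (least Q q)
      least-cong {P} {Q} (P⊆Q , Q⊆P) p q with least P p | least Q q
      ... | m , Pm , m-least | n , Qn , n-least with compare m n
      ... | tri< m<n _ _ = contradiction (P⊆Q Pm) (n-least m<n)
      ... | tri≈ _ m≡n _ = m≡n
      ... | tri> _ _ n<m = contradiction (Q⊆P Qn) (m-least n<m)

    maximum : ∀ {α β γ} → α < γ → β < γ → ∃[ μ ] μ < γ × (∀ {x} → μ < x → α < x × β < x)
    maximum {α} {β} α<γ β<γ with compare α β
    ... | tri< α<β _ _  = β , β<γ , λ β<x → <-trans α<β β<x , β<x
    ... | tri≈ _ refl _ = α , α<γ , λ α<x → α<x , α<x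
    ... | tri> _ _ β<α  = α , α<γ , λ α<x → α<x , <-trans β<α α<x

    ≮-<-trans : ∀ {α β γ} → ¬ β < α → β < γ → α < γ
    ≮-<-trans {α} {β} β≮α β<γ with compare α β
    ... | tri< α<β _ _  = <-trans α<β β<γ
    ... | tri≈ _ refl _ = β<γ
    ... | tri> _ _ β<α  = contradiction β<α β≮α

    segment-coded : ∀ α → Coded (_< α)
    segment-coded α = countable⇒coded (segmentsCountable α)

    closedSegment-coded : ∀ α → Coded (λ β → ¬ α < β)
    closedSegment-coded α = code , injective
      where
      code : W → ℕ
      code β with compare β α
      ... | tri< _ _ _ = suc (proj₁ (segment-coded α) β)
      ... | tri≈ _ _ _ = 0
      ... | tri> _ _ _ = 0

      injective : ∀ {β γ} → ¬ α < β → ¬ α < γ → code β ≡ code γ → β ≡ γ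
      injective {β} {γ} p q eq with compare β α | compare γ α
      ... | tri< β<α _ _  | tri< γ<α _ _  = proj₂ (segment-coded α) β<α γ<α (ℕ.suc-injective eq)
      ... | tri≈ _ refl _ | tri≈ _ refl _ = refl
      ... | tri< _ _ _    | tri≈ _ _ _    = contradiction eq λ ()
      ... | tri≈ _ _ _    | tri< _ _ _    = contradiction eq λ ()
      ... | tri> _ _ α<β  | _             = contradiction α<β p
      ... | _             | tri> _ _ α<γ  = contradiction α<γ q

    abstract
      -- Regularity of ω₁. Without a strict bound, each δ satisfies δ ≤ `g i` for some `i` in `P`;
      -- the code of `i`, paired with that of δ in the countable segment up to `g i`, would inject
      -- ω₁ into ℕ.
      bounded : {I : Set} {P : Pred I 0ℓ} → Coded P → (g : I → W) → ∃[ δ ] (∀ i → P i → g i < δ)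
      bounded {I} {P} (code , injective) g = byContradiction λ unbounded →
        let
          witness : ∀ δ → ∃[ i ] P i × ¬ g i < δ
          witness δ = byContradiction λ none → unbounded
            (δ , λ i Pi → byContradiction λ gi≮δ → none (_ , Pi , gi≮δ))
          index : W → I
          index δ = proj₁ (witness δ)
          codeW : W → ℕ
          codeW δ = pair (code (index δ)) (proj₁ (closedSegment-coded (g (index δ))) δ)
          codeW-injective : ∀ {δ ε} → codeW δ ≡ codeW ε → δ ≡ ε
          codeW-injective {δ} {ε} eq =
            let
              _ , Pi , gi≮δ = witness δ
              _ , Pj , gj≮ε = witness ε
              ci≡cj , eq′   = pair-injective eq
              i≡j           = injective Pi Pj ci≡cj
            in proj₂ (closedSegment-coded (g (index δ))) gi≮δ
                 (subst (λ i → ¬ g i < ε) (sym i≡j) gj≮ε)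
                 (trans eq′ (cong (λ i → proj₁ (closedSegment-coded (g i)) ε) (sym i≡j)))
        in uncountable (record { to = codeW ∘ proj₁ ; cong = cong codeW ; injective = codeW-injective })

    above₂ : ∀ α β → ∃[ γ ] α < γ × β < γ
    above₂ α β =
      let γ , <γ = bounded Coded-Bool λ { false → α ; true → β }
      in γ , <γ false _ , <γ true _

    inhabitant : W
    inhabitant = proj₁ (bounded {⊥} {λ ()} ((λ ()) , λ {}) λ ())

    -- Each x goes to the least strict bound of the values at the earlier elements;
    -- taking the least one makes the recursion unfold without function extensionality.
    module Embedding {A : Set} {_≺_ : Rel A 0ℓ} (≺-wellFounded : WellFounded _≺_)
                     (≺-coded : ∀ x → Coded (_≺ x)) where

      earlier : ∀ x → (∀ {y} → y ≺ x → W) → A → W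
      earlier x rank y with dec (y ≺ x)
      ... | yes y≺x = rank y≺x
      -- The default makes the family total, as `bounded` requires; only the values at `y ≺ x` are
      -- bounded.
      ... | no _    = inhabitant

      step : ∀ x → (∀ {y} → y ≺ x → W) → W
      step x rank = proj₁ (least _ (bounded (≺-coded x) (earlier x rank)))

      earlier<step : ∀ x (rank : ∀ {y} → y ≺ x → W) y → y ≺ x → earlier x rank y < step x rank
      earlier<step x rank = proj₁ (proj₂ (least _ (bounded (≺-coded x) (earlier x rank))))

      earlier-cong : ∀ x {r r′ : ∀ {y} → y ≺ x → W} → (∀ {y} (y≺x : y ≺ x) → r y≺x ≡ r′ y≺x) →
                     ∀ y → earlier x r y ≡ earlier x r′ y
      earlier-cong x r≡r′ y with dec (y ≺ x)
      ... | yes y≺x = r≡r′ y≺x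
      ... | no _    = refl

      step-cong : ∀ x {r r′ : ∀ {y} → y ≺ x → W} → (∀ {y} (y≺x : y ≺ x) → r y≺x ≡ r′ y≺x) →
                  step x r ≡ step x r′
      step-cong x r≡r′ = least-cong
        ( (λ bound y y≺x → subst (_< _) (earlier-cong x r≡r′ y) (bound y y≺x))
        , (λ bound y y≺x → subst (_< _) (sym (earlier-cong x r≡r′ y)) (bound y y≺x)))
        _ _

      abstract
        embed : A → W
        embed = All.wfRec ≺-wellFounded 0ℓ (const W) step

        embed-unfold : ∀ x → embed x ≡ step x (λ {y} _ → embed y)
        embed-unfold x = FixPoint.unfold-wfRec ≺-wellFounded (const W) step step-cong

      embed-mono : ∀ {x y} → x ≺ y → embed x < embed y
      embed-mono {x} {y} x≺y = subst (embed x <_) (sym (embed-unfold y))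
        (subst (_< step y (λ {z} _ → embed z)) earlier≡embed (earlier<step y (λ {z} _ → embed z) x x≺y))
        where
        earlier≡embed : earlier y (λ {z} _ → embed z) x ≡ embed x
        earlier≡embed with dec (x ≺ y)
        ... | yes _  = refl
        ... | no x⊀y = contradiction x≺y x⊀y

    -- The injection `tuple` of ω₁ × ω into ω₁.

    _<ₗₑₓ_ : Rel (W × ℕ) 0ℓ
    _<ₗₑₓ_ = ×-Lex _≡_ _<_ ℕ._<_

    -- A predecessor of `(α , n)` has first coordinate at most α, which leaves countably many pairs.
    <ₗₑₓ-coded : ∀ x → Coded (_<ₗₑₓ x)
    <ₗₑₓ-coded (α , _) = Coded-⊆
      (λ { (inj₁ γ<α) α<γ → irrefl refl (<-trans γ<α α<γ)
         ; (inj₂ (refl , _)) α<α → irrefl refl α<α })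
      (Coded-×ℕ (closedSegment-coded α))

    open Embedding {_≺_ = _<ₗₑₓ_} (×-wellFounded wellFounded ℕ.<-wellFounded) <ₗₑₓ-coded public
      using () renaming (embed to tuple; embed-mono to tuple-mono)

    tuple-injective : ∀ {x y} → tuple x ≡ tuple y → x ≡ y
    tuple-injective {x} {y} eq
      with IsStrictTotalOrder.compare (×-isStrictTotalOrder isStrictTotalOrder ℕ.<-isStrictTotalOrder) x y
    ... | tri< x<y _ _       = contradiction (tuple-mono x<y) (irrefl eq)
    ... | tri≈ _ (p , q) _   = cong₂ _,_ p q
    ... | tri> _ _ y<x       = contradiction (tuple-mono y<x) (irrefl (sym eq))

    -- Clubs and diagonal intersections.

    module DiagonalIntersection {I : Set} (rank : I → W)
      (rank-coded : ∀ α → Coded (λ i → rank i < α))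
      (C : I → Pred W 0ℓ) (C-club : ∀ i → Club Ω (C i)) where

      -- For `I` = ω₁ ranked by the identity this is the usual diagonal intersection, with 0 left
      -- out so that no root has its height in `Δ`.
      Δ : Pred W 0ℓ
      Δ α = Satisfiable (below α) × (∀ i → rank i < α → α ∈ C i)

      Δ-closed : Closed Ω Δ
      Δ-closed α nonempty unbounded = nonempty , λ i ri<α →
        proj₂ (C-club i) α nonempty λ β β<α →
          let
            μ , μ<α , above-μ             = maximum β<α ri<α
            γ , (_ , γ∈C) , μ<γ , γ<α     = unbounded μ μ<α
            β<γ , ri<γ                    = above-μ μ<γ
          in γ , γ∈C i ri<γ , β<γ , γ<α

      -- Between `seq n` and `seq (suc n)` lies a member of every `C i` of rank below `seq n`. Hence
      -- each `C i` of rank below the supremum δ is unbounded in δ and contains it.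
      Δ-unbounded : Unbounded Ω Δ
      Δ-unbounded α = δ , ((α , α<δ) , δ∈C) , α<δ
        where
        member : ∀ β i → ∃[ γ ] γ ∈ C i × β < γ
        member β i = proj₁ (C-club i) β

        bound : ∀ β → ∃[ γ ] (∀ i → rank i < β → proj₁ (member β i) < γ)
        bound β = bounded (rank-coded β) (λ i → proj₁ (member β i))

        next : ∀ β → ∃[ γ ] β < γ × proj₁ (bound β) < γ
        next β = above₂ β (proj₁ (bound β))

        seq : ℕ → W
        seq zero    = α
        seq (suc n) = proj₁ (next (seq n))

        limit : ∃ (Least (λ δ → ∀ n → n ∈ U → seq n < δ))
        limit = least _ (bounded (id , λ _ _ → id) seq)

        δ = proj₁ limit

        α<δ : α < δ
        α<δ = proj₁ (proj₂ limit) 0 _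

        below-seq : ∀ {β} → β < δ → ∃[ n ] β < seq n
        -- If β ≤ `seq n`, the next term exceeds β; so if no term did, β would be a strict bound
        -- smaller than δ.
        below-seq {β} β<δ = byContradiction λ none → proj₂ (proj₂ limit) β<δ λ n _ →
          byContradiction λ sn≮β → none
            (suc n , ≮-<-trans sn≮β (proj₁ (proj₂ (next (seq n)))))

        δ∈C : ∀ i → rank i < δ → δ ∈ C i
        δ∈C i ri<δ = proj₂ (C-club i) δ (α , α<δ) λ β β<δ →
          let
            μ , μ<δ , above-μ = maximum β<δ ri<δ
            n , μ<sn          = below-seq μ<δ
            β<sn , ri<sn      = above-μ μ<sn
            γ , γ∈C , sn<γ    = member (seq n) i
            γ<s               = <-trans (proj₂ (bound (seq n)) i ri<sn) (proj₂ (proj₂ (next (seq n))))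
          in γ , γ∈C , <-trans β<sn sn<γ , <-trans γ<s (proj₁ (proj₂ limit) (suc n) _)

      Δ-club : Club Ω Δ
      Δ-club = Δ-unbounded , Δ-closed

    final-club : ∀ β → Club Ω (β <_)
    final-club β =
      (λ α → let γ , α<γ , β<γ = above₂ α β in γ , β<γ , α<γ) ,
      (λ α (x , x<α) unbounded →
        let γ , β<γ , _ , γ<α = unbounded x x<α in <-trans β<γ γ<α)

    rank-tuple-coded : ∀ α → Coded {W × ℕ} (λ x → proj₁ x < α)
    rank-tuple-coded α = Coded-×ℕ (segment-coded α)

    disjointClub : ∀ {S} → Nonstationary Ω S → Σ[ C ∈ Pred W 0ℓ ] Club Ω C × ¬ (S ≬ C)
    disjointClub nonstationary = byContradiction₁ λ none → nonstationary λ C C-club →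
      byContradiction λ disjoint → none (C , C-club , disjoint)

  -- Heights of nodes in an ω₁-tree.

  module Heights (Ω : Omega₁) (𝕋 : Tree) (isOmega₁Tree : IsOmega₁Tree 𝕋 Ω) where
    open Ordinal Ω
    open Omega₁ Ω using (below; isWellOrder) renaming (Carrier to W; _<_ to _<Ω_)
    open IsStrictTotalOrder (IsWellOrder.isStrictTotalOrder isWellOrder) using (compare)
      renaming (trans to <Ω-trans; irrefl to <Ω-irrefl)
    open Tree 𝕋 renaming (Carrier to T)
    open IsStrictPartialOrder isStrictPartialOrder using () renaming (trans to <-trans; irrefl to <-irrefl)
    open IsOmega₁Tree isOmega₁Tree
    open Height-ω₁ height-ω₁

    <-wellFounded : WellFounded _<_
    <-wellFounded t = acc λ {s} s<t → accessible s<t (IsWellOrder.wellFounded (↓-isWellOrder t) (s , s<t))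
      where
      accessible : ∀ {s} (s<t : s < t) → Acc (_<_ on proj₁) (s , s<t) → Acc _<_ s
      accessible s<t (acc rs) = acc λ r<s → accessible (<-trans r<s s<t) (rs r<s)

    -- Since `t ↓` is totally ordered, strict monotonicity yields injectivity and reflection of the
    -- order.
    orderIsomorphic : ∀ {t} {Q : Pred W 0ℓ} (h : Σ T (t ↓) → W) →
      (∀ {x y} → proj₁ x ≡ proj₁ y → h x ≡ h y) →
      (∀ {x y} → proj₁ x < proj₁ y → h x <Ω h y) →
      (∀ x → Q (h x)) → (∀ β → Q β → ∃[ x ] h x ≡ β) →
      OrderIsomorphic (t ↓) _<_ Q _<Ω_
    orderIsomorphic {t} h h-cong h-mono h-into h-onto = (λ x → h x , h-into x) , record
      { isOrderMonomorphism = record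
        { isOrderHomomorphism = record
          { cong = λ {x} {y} → h-cong {x} {y}
          ; mono = λ {x} {y} → h-mono {x} {y}
          }
        ; injective = λ {x} {y} → injective x y
        ; cancel    = λ {x} {y} → cancel x y
        }
      ; surjective = λ (β , Qβ) →
          let x , hx≡β = h-onto β Qβ in x , λ {z} z≡x → trans (h-cong {z} {x} z≡x) hx≡β
      }
      where
      compare-↓ : ∀ x y → Tri (proj₁ x < proj₁ y) (proj₁ x ≡ proj₁ y) (proj₁ y < proj₁ x)
      compare-↓ = IsStrictTotalOrder.compare (IsWellOrder.isStrictTotalOrder (↓-isWellOrder t))

      injective : ∀ x y → h x ≡ h y → proj₁ x ≡ proj₁ y
      injective x y eq with compare-↓ x y
      ... | tri< x<y _ _ = contradiction (h-mono {x} {y} x<y) (<Ω-irrefl eq)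
      ... | tri≈ _ x≡y _ = x≡y
      ... | tri> _ _ y<x = contradiction (h-mono {y} {x} y<x) (<Ω-irrefl (sym eq))

      cancel : ∀ x y → h x <Ω h y → proj₁ x < proj₁ y
      cancel x y lt with compare-↓ x y
      ... | tri< x<y _ _ = x<y
      ... | tri≈ _ x≡y _ = contradiction lt (<Ω-irrefl (h-cong {x} {y} x≡y))
      ... | tri> _ _ y<x = contradiction (<Ω-trans (h-mono {y} {x} y<x) lt) (<Ω-irrefl refl)

    module LevelIso {t α} (level : Level 𝕋 Ω α t) where
      open IsOrderIsomorphism (proj₂ level) public using (mono; cancel)

      to : ∀ {s} → s < t → W
      to s<t = proj₁ (proj₁ level (_ , s<t))

      to< : ∀ {s} (s<t : s < t) → to s<t <Ω α
      to< s<t = proj₂ (proj₁ level (_ , s<t))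

      onto : ∀ {β} → β <Ω α → Σ[ s ∈ T ] Σ[ s<t ∈ s < t ] to s<t ≡ β
      onto β<α =
        let (s , s<t) , eq = IsOrderIsomorphism.surjective (proj₂ level) (_ , β<α)
        in s , s<t , eq refl

      restrict : ∀ {s} (s<t : s < t) → Level 𝕋 Ω (to s<t) s
      restrict {s} s<t = orderIsomorphic
        (λ (r , r<s) → to (<-trans r<s s<t))
        (IsOrderIsomorphism.cong (proj₂ level))
        mono
        (λ (_ , r<s) → mono r<s)
        (λ β β<s →
          let r , r<t , eq = onto (<Ω-trans β<s (to< s<t))
              r<s          = cancel {_ , r<t} {_ , s<t} (subst (_<Ω to s<t) (sym eq) β<s)
          in (r , r<s) , trans (IsOrderIsomorphism.cong (proj₂ level) refl) eq)

    -- If α < β, some s below t goes to α under the second isomorphism and, by induction, under the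
    -- first too, whose values are all below α.
    Level-unique : ∀ t {α β} → Level 𝕋 Ω α t → Level 𝕋 Ω β t → α ≡ β
    Level-unique = All.wfRec <-wellFounded 0ℓ (λ t → ∀ {α β} → Level 𝕋 Ω α t → Level 𝕋 Ω β t → α ≡ β)
      λ t unique → step t unique
      where
      module _ (t : T) (unique : ∀ {s} → s < t → ∀ {α β} → Level 𝕋 Ω α s → Level 𝕋 Ω β s → α ≡ β) where
        ≮ : ∀ {α β} → Level 𝕋 Ω α t → Level 𝕋 Ω β t → ¬ α <Ω β
        ≮ {α} level level′ α<β =
          let
            s , s<t , eq = LevelIso.onto level′ α<β
            eq′ = unique s<t (LevelIso.restrict level s<t) (LevelIso.restrict level′ s<t)
          in <Ω-irrefl (trans eq′ eq) (LevelIso.to< level s<t)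

        step : ∀ {α β} → Level 𝕋 Ω α t → Level 𝕋 Ω β t → α ≡ β
        step {α} {β} level level′ with compare α β
        ... | tri< α<β _ _ = contradiction α<β (≮ level level′)
        ... | tri≈ _ α≡β _ = α≡β
        ... | tri> _ _ β<α = contradiction β<α (≮ level′ level)

    module LevelStep (t : T) (levels : ∀ {s} → s < t → ∃[ α ] Level 𝕋 Ω α s) where
      h : Σ T (t ↓) → W
      h (s , s<t) = proj₁ (levels s<t)

      h-cong : ∀ {x y} → proj₁ x ≡ proj₁ y → h x ≡ h y
      h-cong {_ , p} {_ , q} refl = Level-unique _ (proj₂ (levels p)) (proj₂ (levels q))

      h-mono : ∀ {x y} → proj₁ x < proj₁ y → h x <Ω h y
      h-mono {_ , r<t} {_ , s<t} r<s =
        subst (_<Ω proj₁ (levels s<t))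
          (Level-unique _ (LevelIso.restrict (proj₂ (levels s<t)) r<s) (proj₂ (levels r<t)))
          (LevelIso.to< (proj₂ (levels s<t)) r<s)

      Range : Pred W 0ℓ
      Range β = ∃[ x ] h x ≡ β

      Range-down : ∀ x {β} → β <Ω h x → Range β
      Range-down (s , s<t) β<hs =
        let
          r , r<s , eq = LevelIso.onto (proj₂ (levels s<t)) β<hs
          r<t          = <-trans r<s s<t
        in (r , r<t) , trans (Level-unique r (proj₂ (levels r<t)) (LevelIso.restrict (proj₂ (levels s<t)) r<s)) eq

      -- The heights of the predecessors form an initial segment of ω₁. It is not all of ω₁, as no
      -- node has height ω₁, so its least missing element is the height of `t`.
      level : ∃[ α ] Level 𝕋 Ω α t
      level with dec (∃[ β ] ¬ Range β)
      ... | no none = contradiction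
            (t , orderIsomorphic h h-cong h-mono (λ _ → _)
                   (λ β _ → byContradiction λ β∉ → none (β , β∉)))
            level-ω₁-empty
      ... | yes some with least _ some
      ...   | α , α∉ , α-least = α , orderIsomorphic h h-cong h-mono into
                (λ β β<α → byContradiction (α-least β<α))
        where
        into : ∀ x → h x <Ω α
        into x with compare (h x) α
        ... | tri< lt _ _ = lt
        ... | tri≈ _ eq _ = contradiction (x , eq) α∉
        ... | tri> _ _ gt = contradiction (Range-down x gt) α∉

    abstract
      ht-level : ∀ t → ∃[ α ] Level 𝕋 Ω α t
      ht-level = All.wfRec <-wellFounded 0ℓ (λ t → ∃[ α ] Level 𝕋 Ω α t) LevelStep.level

    ht : T → W
    ht t = proj₁ (ht-level t)

    level-ht : ∀ t → Level 𝕋 Ω (ht t) t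
    level-ht t = proj₂ (ht-level t)

    Level⇒ht : ∀ {α t} → Level 𝕋 Ω α t → ht t ≡ α
    Level⇒ht {t = t} = Level-unique t (level-ht t)

    ht-mono : ∀ {s t} → s < t → ht s <Ω ht t
    ht-mono {s} {t} s<t = subst (_<Ω ht t)
      (sym (Level⇒ht (LevelIso.restrict (level-ht t) s<t))) (LevelIso.to< (level-ht t) s<t)

    node-below : ∀ {t β} → β <Ω ht t → ∃[ s ] s < t × ht s ≡ β
    node-below {t} β<ht =
      let s , s<t , eq = LevelIso.onto (level-ht t) β<ht
      in s , s<t , trans (Level⇒ht (LevelIso.restrict (level-ht t) s<t)) eq

    node-at : ∀ α → ∃[ t ] ht t ≡ α
    node-at α = let t , level = levels-nonempty α in t , Level⇒ht level

    ht-root≤ : ∀ t → ¬ ht t <Ω ht root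
    ht-root≤ t lt =
      let s , s<root , _ = node-below lt
          s≢root         = λ s≡root → <-irrefl s≡root s<root
      in <-irrefl refl (<-trans s<root (root-least s s≢root))

    index : T → ℕ
    index t = Injection.to (levels-countable (ht t)) (t , level-ht t)

    ht-index-injective : ∀ {s t} → ht s ≡ ht t → index s ≡ index t → s ≡ t
    ht-index-injective {s} {t} = lemma (level-ht s) (level-ht t)
      where
      -- Arbitrary α and β allow matching on their equality, which `ht s ≡ ht t` does not.
      lemma : ∀ {α β} (p : Level 𝕋 Ω α s) (q : Level 𝕋 Ω β t) → α ≡ β →
              Injection.to (levels-countable α) (s , p) ≡ Injection.to (levels-countable β) (t , q) → s ≡ t
      lemma {α} p q refl = Injection.injective (levels-countable α)

    -- A countable union of countable levels.
    ht-coded : ∀ α → Coded (λ t → ht t <Ω α)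
    ht-coded α =
      (λ t → pair (code (ht t)) (index t)) ,
      λ s<α t<α eq →
        let eq₁ , eq₂ = pair-injective eq in ht-index-injective (injective s<α t<α eq₁) eq₂
      where
      code = proj₁ (segment-coded α)
      injective = proj₂ (segment-coded α)

    nodeCode : T → W
    nodeCode t = tuple (ht t , index t)

    nodeCode-injective : ∀ {s t} → nodeCode s ≡ nodeCode t → s ≡ t
    nodeCode-injective eq =
      let eq′ = tuple-injective eq
      in ht-index-injective (cong proj₁ eq′) (cong proj₂ eq′)

  module _ (Ω : Omega₁) (𝕋 : Tree) (almostSuslin : AlmostSuslin 𝕋 Ω) where
    open AlmostSuslin almostSuslin
    open Ordinal Ω
    open Heights Ω 𝕋 isOmega₁Tree
    open Omega₁ Ω using (below) renaming (Carrier to W; _<_ to _<Ω_)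
    open Tree 𝕋 renaming (Carrier to T)

    -- From ◇ to ◇ on the tree.

    diamond⇒treeDiamond : Diamond Ω → TreeDiamond 𝕋
    diamond⇒treeDiamond (D , _ , guesses) =
      D-tree , (λ t → proj₁) , λ X (f , regressive , special) → refute X f regressive special
      where
      D-tree : T → Pred T 0ℓ
      D-tree t s = s < t × nodeCode s ∈ D (ht t)

      module _ (X : Pred T 0ℓ) where
        B : Pred T 0ℓ
        B t = (X ∩ t ↓) ≐ D-tree t

        X-code : Pred W 0ℓ
        X-code β = ∃[ s ] X s × nodeCode s ≡ β

        module _ (f : Func ⟪ B ⟫ (setoid T)) (regressive : Regressive 𝕋 B f)
                 (special : ∀ s → Special 𝕋 (fibre 𝕋 B f s)) where

          antichain-club : ∀ s n → Σ[ C ∈ Pred W 0ℓ ] Club Ω C × ¬ (heights 𝕋 Ω (proj₁ (special s) n) ≬ C)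
          antichain-club s n = disjointClub
            (antichains-nonstationary _ (proj₁ (proj₂ (special s)) n))

          -- One index for each antichain of each fibre, and one for each pair `(β , n)`; the latter
          -- make every element of `Δ` closed under `tuple`.
          I : Set
          I = (T × ℕ) ⊎ (W × ℕ)

          rank : I → W
          rank = [ ht ∘ proj₁ , proj₁ ]

          C : I → Pred W 0ℓ
          C (inj₁ (s , n)) = proj₁ (antichain-club s n)
          C (inj₂ x)       = tuple x <Ω_

          C-club : ∀ i → Club Ω (C i)
          C-club (inj₁ (s , n)) = proj₁ (proj₂ (antichain-club s n))
          C-club (inj₂ x)       = final-club (tuple x)

          open DiagonalIntersection rank
            (λ α → Coded-⊎ (Coded-×ℕ (ht-coded α)) (rank-tuple-coded α)) C C-club

          -- A correct guess at `ht t` puts `t` in `B`, hence in an antichain of the fibre over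
          -- `s = f t`. As `ht s` is below `ht t`, membership in `Δ` puts `ht t` in the club
          -- avoiding the heights of that antichain.
          no-node : ∀ t → ht t ∈ Δ → ¬ ((X-code ∩ below (ht t)) ≐ D (ht t))
          no-node t ((β , β<t) , t∈C) (X⊆D , D⊆X) =
            let n , t∈A = proj₁ (proj₂ (proj₂ (special s))) (t∈B , refl)
            in proj₂ (proj₂ (antichain-club s n))
                 (ht t , (t , t∈A , level-ht t) , t∈C (inj₁ (s , n)) (ht-mono s<t))
            where
            t∈B : t ∈ B
            t∈B =
              (λ {r} (r∈X , r<t) → r<t ,
                -- Closure under `tuple` puts the code of `r` below `ht t`.
                X⊆D ((r , r∈X , refl) , t∈C (inj₂ (ht r , index r)) (ht-mono r<t))) ,
              (λ {r} (r<t , r∈D) →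
                let r′ , r′∈X , eq = proj₁ (D⊆X r∈D)
                in subst X (nodeCode-injective eq) r′∈X , r<t)

            s : T
            s = Func.to f (t , t∈B)

            t≢root : t ≢ root
            t≢root refl = let r , r<t , _ = node-below β<t in ht-root≤ r (ht-mono r<t)

            s<t : s < t
            s<t = regressive t t∈B t≢root

          refute : ⊥
          refute =
            let
              α , guess , α∈Δ = guesses X-code Δ Δ-club
              t , ht≡α        = node-at α
            in no-node t (subst Δ (sym ht≡α) α∈Δ)
                 (subst (λ α → (X-code ∩ below α) ≐ D α) (sym ht≡α) guess)

    -- From ◇ on the tree to ◇.

    -- The fibres of f(t) := some s < t with no element of C in (ht s, ht t) are
    -- countable, because ht t is bounded by the next element of C above ht s.
    avoids-club⇒NS : ∀ {B C} → Club Ω C → (∀ t → t ∈ B → ¬ ht t ∈ C) → NS 𝕋 B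
    avoids-club⇒NS {B} {C} (unbounded , closed) avoids =
      record { to = f ∘ proj₁ ; cong = cong f } , f-regressive , fibre-special
      where
      Gap : T → T → Set
      Gap s t = ¬ (∃[ γ ] γ ∈ C × ht s <Ω γ × γ <Ω ht t)

      f : T → T
      f t with dec (∃[ s ] s < t × Gap s t)
      ... | yes (s , _) = s
      ... | no _        = root

      f-regressive : ∀ t → t ∈ B → t ≢ root → f t < t
      f-regressive t t∈B t≢root with dec (∃[ s ] s < t × Gap s t)
      ... | yes (_ , s<t , _) = s<t
      ... | no _              = root-least t t≢root

      f-gap : ∀ t → t ∈ B → Gap (f t) t
      f-gap t t∈B with dec (∃[ s ] s < t × Gap s t)
      ... | yes (_ , _ , gap) = gap
      -- With no gap below `t`, `C` is unbounded in `ht t`, so closedness would put `ht t` in `C`;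
      -- here `γ` witnesses that `ht t` is not 0.
      ... | no none = λ (γ , _ , root<γ , γ<t) → avoids t t∈B
              (closed (ht t) (γ , γ<t) λ β β<t →
                let s , s<t , hs≡β = node-below β<t
                in subst (λ β → ∃[ γ ] γ ∈ C × β <Ω γ × γ <Ω ht t) hs≡β
                     (byContradiction λ gap → none (s , s<t , gap)))

      fibre-special : ∀ s → Special 𝕋 (fibre 𝕋 B (record { to = f ∘ proj₁ ; cong = cong f }) s)
      fibre-special s =
        let
          γ , γ∈C , s<γ = unbounded (ht s)
          -- On the fibre `ht t` ≤ γ, whereas `ht-coded` takes a strict bound.
          δ , γ<δ , _   = above₂ γ γ
        in coded⇒special 𝕋 (Coded-⊆
             (λ { {t} (t∈B , refl) → ≮-<-trans (λ γ<t → f-gap t t∈B (γ , γ∈C , s<γ , γ<t)) γ<δ })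
             (ht-coded δ))

    -- Kunen's argument that countably many guesses at each α can be reduced to
    -- one: the n-th candidate at α reads the n-th coordinate of the guess at the
    -- n-th node of height α; if X n refutes the n-th candidate for every n, then
    -- the tree diamond fails for the set coding all the X n simultaneously.
    treeDiamond⇒diamond : TreeDiamond 𝕋 → Diamond Ω
    treeDiamond⇒diamond (D , _ , guesses) =
      let n , n-guesses = some-guesses in candidate n , (λ α → proj₁) , n-guesses
      where
      -- The node of height `tuple (β , n)` below `t` decides whether β belongs to the guess. If no
      -- node of height α has index `n`, the candidate is empty.
      candidate : ℕ → W → Pred W 0ℓ
      candidate n α β = β <Ω α ×
        (∃[ t ] ∃[ s ] (ht t ≡ α × index t ≡ n) × s < t × ht s ≡ tuple (β , n) × s ∈ D t)

      Guessed : ℕ → Pred W 0ℓ → Pred W 0ℓ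
      Guessed n X α = (X ∩ below α) ≐ candidate n α

      module _ (X : ℕ → Pred W 0ℓ)
               (failure : ∀ n → Σ[ C ∈ Pred W 0ℓ ] Club Ω C × ¬ (Guessed n (X n) ≬ C)) where
        I : Set
        I = ℕ ⊎ (W × ℕ)

        rank : I → W
        -- `ht root` is 0, so each element of `Δ` lies in all the clubs of `failure`.
        rank = [ const (ht root) , proj₁ ]

        C : I → Pred W 0ℓ
        C (inj₁ n) = proj₁ (failure n)
        C (inj₂ x) = tuple x <Ω_

        C-club : ∀ i → Club Ω (C i)
        C-club (inj₁ n) = proj₁ (proj₂ (failure n))
        C-club (inj₂ x) = final-club (tuple x)

        open DiagonalIntersection rank
          (λ α → Coded-⊎ (id , λ _ _ → id) (rank-tuple-coded α)) C C-club

        -- A union of whole levels, so that the branch below any single node reads off the sets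
        -- `X n` by heights alone.
        X-all : Pred T 0ℓ
        X-all s = ∃[ n ] ∃[ β ] ht s ≡ tuple (β , n) × β ∈ X n

        -- For `n = index t`, a correct guess of `X-all` at `t` makes the `n`-th candidate at `ht t`
        -- correct for `X n`, which the club of `failure n` excludes.
        not-guessed : ∀ t → (X-all ∩ t ↓) ≐ D t → ¬ ht t ∈ Δ
        not-guessed t (X⊆D , D⊆X) ((β , β<t) , t∈C) =
          proj₂ (proj₂ (failure n)) (ht t , (⊆-candidate , candidate-⊆) , t∈C (inj₁ n) root<t)
          where
          n : ℕ
          n = index t

          root<t : ht root <Ω ht t
          root<t = let s , s<t , _ = node-below β<t in ≮-<-trans (ht-root≤ s) (ht-mono s<t)

          ⊆-candidate : (X n ∩ below (ht t)) ⊆ candidate n (ht t)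
          ⊆-candidate {β} (β∈X , β<t) =
            let s , s<t , hs≡ = node-below (t∈C (inj₂ (β , n)) β<t)
            in β<t , t , s , (refl , refl) , s<t , hs≡ , X⊆D ((n , β , hs≡ , β∈X) , s<t)

          candidate-⊆ : candidate n (ht t) ⊆ (X n ∩ below (ht t))
          candidate-⊆ {β} (β<t , t′ , s , (ht≡ , index≡) , _ , hs≡ , s∈D) =
            let
              s∈D′             = subst (λ t → s ∈ D t) (ht-index-injective ht≡ index≡) s∈D
              m , γ , eq , γ∈X = proj₁ (D⊆X s∈D′)
              -- The height of `s` codes both `(γ , m)` and `(β , n)`.
              same             = tuple-injective (trans (sym eq) hs≡)
            in subst (λ x → proj₁ x ∈ X (proj₂ x)) same γ∈X , β<t

        contradictory : ⊥
        contradictory = guesses X-all (avoids-club⇒NS Δ-club not-guessed)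

      some-guesses : ∃[ n ] (∀ X → Stationary Ω (Guessed n X))
      some-guesses = byContradiction₁ λ none →
        let
          fails : ∀ n → Σ[ X ∈ Pred W 0ℓ ] Nonstationary Ω (Guessed n X)
          fails n = byContradiction₁ λ never → none
            (n , λ X → byContradiction₁ λ nonstationary → never (X , nonstationary))
        in contradictory (λ n → proj₁ (fails n)) (λ n → disjointClub (proj₂ (fails n)))

theorem4p13 : Classical → (Ω : Omega₁) (𝕋 : Tree) →
    AlmostSuslin 𝕋 Ω → TreeDiamond 𝕋 ⇔ Diamond Ω
theorem4p13 em Ω 𝕋 almostSuslin =
  mk⇔ (treeDiamond⇒diamond em Ω 𝕋 almostSuslin) (diamond⇒treeDiamond em Ω 𝕋 almostSuslin)
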